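{- For all integers $m,n\ge 1$, $\chi_{lt}(mC_6+nP_6)=2n+1$.
   Context: $G+H$ is the disjoint union of $G$ and $H$, $mG$ is the disjoint union of $m$ copies of $G$, $P_n$ is the path on $n$ vertices and $C_n$ is the cycle on $n$ vertices. For a finite simple graph $G=(V,E)$ of order $p$ and size $q$, a local total antimagic labeling is a bijection $f:V\cup E\to\{1,\dots,p+q\}$ such that, with weights $w_f(u)=\sum f(e)$ over all edges $e$ incident to $u$ for $u\in V$ (the label of $u$ itself is not included) and $w_f(uv)=f(u)+f(v)$ for $uv\in E$, one has: adjacent vertices have distinct weights, adjacent edges have distinct weights, and every vertex has a weight distinct from that of each of its incident edges. $\chi_{lt}(G)$ is the minimum, over all local total antimagic labelings $f$ of $G$, of the number of distinct values among all the vertex and edge weights. -}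

module Defs where

open import Data.Empty using (⊥-elim)
open import Data.Fin using (Fin; zero; suc; toℕ; fromℕ; inject₁)
import Data.Fin.Properties as Fin
open import Data.List using (List; _++_; map; filter; sum; length; allFin; deduplicate)
open import Data.Nat using (ℕ; zero; suc; _+_; _*_; _≤_; _≤?_; _≟_; NonZero)
open import Data.Nat.Properties using (m≢1+n+m; 1+n≢n)
open import Data.Product as Prod using (∃-syntax; _×_; _,_; proj₁; proj₂)
open import Data.Product.Function.NonDependent.Propositional using (_×-↔_)
open import Data.Sum as Sum using (_⊎_; inj₁; inj₂)
open import Data.Sum.Function.Propositional using (_⊎-↔_)
open import Data.Sum.Properties using (inj₁-injective; inj₂-injective)
open import Function using (_∘_)
open import Function.Bundles using (_↔_; _⤖_; module Inverse; module Bijection)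
open import Function.Construct.Composition using (_↔-∘_)
open import Function.Construct.Identity using (↔-id)
open import Function.Properties.Inverse using (↔-sym; ↔⇒↣)
open import Relation.Binary.Definitions using (DecidableEquality)
open import Relation.Binary.PropositionalEquality
  using (_≡_; _≢_; refl; sym; trans; cong; cong₂)
open import Relation.Nullary using (¬_; Dec)
open import Relation.Nullary.Decidable using (True; via-injection; _⊎-dec_)

-- A finite simple graph. Edges form a type of their own; listing the endpoints
-- of an edge as (src , tgt) is only bookkeeping and carries no orientation, as
-- every notion below is symmetric in the two. By `noParallel`, an edge is
-- determined by its unordered pair of endpoints.
record Graph : Set₁ where
  field
    V E   : Set
    order : ℕ
    size  : ℕ
    enumV : Fin order ↔ V
    enumE : Fin size ↔ E
    src   : E → V
    tgt   : E → V

  Joins : E → V → V → Set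
  Joins e u v = (src e ≡ u × tgt e ≡ v) ⊎ (src e ≡ v × tgt e ≡ u)

  field
    loopless   : ∀ e → src e ≢ tgt e
    noParallel : ∀ e e′ → Joins e (src e′) (tgt e′) → e ≡ e′

  _≟ⱽ_ : DecidableEquality V
  _≟ⱽ_ = via-injection (↔⇒↣ (↔-sym enumV)) Fin._≟_

  vertices : List V
  vertices = map (Inverse.to enumV) (allFin order)

  edges : List E
  edges = map (Inverse.to enumE) (allFin size)

  Incident : V → E → Set
  Incident v e = src e ≡ v ⊎ tgt e ≡ v

  incident? : ∀ v e → Dec (Incident v e)
  incident? v e = (src e ≟ⱽ v) ⊎-dec (tgt e ≟ⱽ v)

  AdjacentV : V → V → Set
  AdjacentV u v = ∃[ e ] Joins e u v

  AdjacentE : E → E → Set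
  AdjacentE e e′ = e ≢ e′ × ∃[ v ] (Incident v e × Incident v e′)

module _ (G : Graph) where
  open Graph G

  -- A bijection V ∪ E → {1,…,p+q}; the element i : Fin (p + q) stands for the
  -- label toℕ i + 1.
  Labeling : Set
  Labeling = (V ⊎ E) ⤖ Fin (order + size)

  module _ (f : Labeling) where

    label : V ⊎ E → ℕ
    label x = suc (toℕ (Bijection.to f x))

    weightV : V → ℕ
    weightV u = sum (map (label ∘ inj₂) (filter (incident? u) edges))

    weightE : E → ℕ
    weightE e = label (inj₁ (src e)) + label (inj₁ (tgt e))

    record IsLocalTotalAntimagic : Set where
      field
        vertex-vertex : ∀ u v → AdjacentV u v → weightV u ≢ weightV v
        edge-edge     : ∀ e e′ → AdjacentE e e′ → weightE e ≢ weightE e′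
        vertex-edge   : ∀ v e → Incident v e → weightV v ≢ weightE e

    numWeights : ℕ
    numWeights = length (deduplicate _≟_ (map weightV vertices ++ map weightE edges))

-- χₗₜ is a relation rather than a function, since the minimum need not exist:
-- a graph with a component P₂ has no local total antimagic labeling.
χₗₜ[_]≡_ : Graph → ℕ → Set
χₗₜ[ G ]≡ k =
  (∃[ f ] (IsLocalTotalAntimagic G f × numWeights G f ≡ k)) ×
  (∀ f → IsLocalTotalAntimagic G f → k ≤ numWeights G f)

infixl 6 _⊕_
infixr 7 _·_

_⊕_ : Graph → Graph → Graph
G ⊕ H = record
  { V     = G.V ⊎ H.V
  ; E     = G.E ⊎ H.E
  ; order = G.order + H.order
  ; size  = G.size + H.size
  ; enumV = (G.enumV ⊎-↔ H.enumV) ↔-∘ Fin.+↔⊎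
  ; enumE = (G.enumE ⊎-↔ H.enumE) ↔-∘ Fin.+↔⊎
  ; src   = Sum.map G.src H.src
  ; tgt   = Sum.map G.tgt H.tgt
  ; loopless = λ where
      (inj₁ e) p → G.loopless e (inj₁-injective p)
      (inj₂ e) p → H.loopless e (inj₂-injective p)
  ; noParallel = λ where
      (inj₁ e) (inj₁ e′) p → cong inj₁ (G.noParallel e e′
        (Sum.map (Prod.map inj₁-injective inj₁-injective)
                 (Prod.map inj₁-injective inj₁-injective) p))
      (inj₂ e) (inj₂ e′) p → cong inj₂ (H.noParallel e e′
        (Sum.map (Prod.map inj₂-injective inj₂-injective)
                 (Prod.map inj₂-injective inj₂-injective) p))
      (inj₁ _) (inj₂ _) (inj₁ (() , _))
      (inj₁ _) (inj₂ _) (inj₂ (() , _))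
      (inj₂ _) (inj₁ _) (inj₁ (() , _))
      (inj₂ _) (inj₁ _) (inj₂ (() , _))
  }
  where
    module G = Graph G
    module H = Graph H

_·_ : ℕ → Graph → Graph
m · G = record
  { V     = Fin m × G.V
  ; E     = Fin m × G.E
  ; order = m * G.order
  ; size  = m * G.size
  ; enumV = (↔-id _ ×-↔ G.enumV) ↔-∘ Fin.*↔×
  ; enumE = (↔-id _ ×-↔ G.enumE) ↔-∘ Fin.*↔×
  ; src   = Prod.map₂ G.src
  ; tgt   = Prod.map₂ G.tgt
  ; loopless = λ e p → G.loopless (proj₂ e) (cong proj₂ p)
  ; noParallel = λ where
      (_ , e) (_ , e′) (inj₁ (p , q)) → cong₂ _,_ (cong proj₁ p)
        (G.noParallel e e′ (inj₁ (cong proj₂ p , cong proj₂ q)))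
      (_ , e) (_ , e′) (inj₂ (p , q)) → cong₂ _,_ (cong proj₁ p)
        (G.noParallel e e′ (inj₂ (cong proj₂ p , cong proj₂ q)))
  }
  where module G = Graph G

-- Vertices 0,…,n-1; edge i joins i and i+1.
P : (n : ℕ) → .{{NonZero n}} → Graph
P (suc k) = record
  { V     = Fin (suc k)
  ; E     = Fin k
  ; order = suc k
  ; size  = k
  ; enumV = ↔-id _
  ; enumE = ↔-id _
  ; src   = inject₁
  ; tgt   = suc
  ; loopless = λ i p → inject₁≢suc i p
  ; noParallel = λ where
      i j (inj₁ (p , _)) → Fin.inject₁-injective p
      i j (inj₂ (p , q)) → ⊥-elim (swap-absurd i j p q)
  }
  where
    inject₁≢suc : ∀ {k} (i : Fin k) → inject₁ i ≢ suc i
    inject₁≢suc i p = 1+n≢n (trans (sym (cong toℕ p)) (Fin.toℕ-inject₁ i))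

    swap-absurd : (i j : Fin k) → inject₁ i ≡ suc j → ¬ (suc i ≡ inject₁ j)
    swap-absurd i j p q = m≢1+n+m (toℕ i) {1} (trans
      (trans (sym (Fin.toℕ-inject₁ i)) (cong toℕ p))
      (cong suc (trans (sym (Fin.toℕ-inject₁ j)) (sym (cong toℕ q)))))

cyclicPred : ∀ {n} → Fin n → Fin n
cyclicPred {suc k} zero    = fromℕ k
cyclicPred {suc k} (suc i) = inject₁ i

-- Vertices 0,…,n-1; edge i joins i-1 and i, indices modulo n.
C : (n : ℕ) → {True (3 ≤? n)} → Graph
C (suc (suc (suc k))) = record
  { V     = Fin (3 + k)
  ; E     = Fin (3 + k)
  ; order = 3 + k
  ; size  = 3 + k
  ; enumV = ↔-id _
  ; enumE = ↔-id _
  ; src   = cyclicPred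
  ; tgt   = λ i → i
  ; loopless = pred≢
  ; noParallel = λ where
      i j (inj₁ (_ , q)) → q
      i j (inj₂ (p , q)) → ⊥-elim (pred²≢ i j p q)
  }
  where
    pred≢ : (i : Fin (3 + k)) → cyclicPred i ≢ i
    pred≢ zero    ()
    pred≢ (suc i) p = 1+n≢n (trans (sym (cong toℕ p)) (Fin.toℕ-inject₁ i))

    pred²≢ : (i j : Fin (3 + k)) → cyclicPred i ≡ j → ¬ (i ≡ cyclicPred j)
    pred²≢ zero          _ refl ()
    pred²≢ (suc zero)    _ refl ()
    pred²≢ (suc (suc i)) _ refl q = m≢1+n+m (toℕ i) {1} (sym (trans
      (cong toℕ q) (trans (Fin.toℕ-inject₁ (inject₁ i)) (Fin.toℕ-inject₁ i))))

module Submission where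

-- Lower bound. The two leaves of each P₆ weigh as much as the labels of their
-- pendant edges, so 2n weights are distinct; the neighbour of the heaviest leaf
-- is heavier still.
--
-- Upper bound. Put b = 12m + 9n + 1. Start from a labelling of (m + n) C₆ by
-- 1-n,…,12m+11n and delete from each of n cycles one edge, the deleted labels
-- being 1-n,…,0. The weights of each of these cycles were b, b+n, b+2n, repeating
-- in this order around the cycle (vertices and edges alternating); deleting the
-- edge labelled -j from one of them raises the weights of the two new leaves to
-- b+n+j and b+j. The other cycles use b+n-1, b+n, b+n+1. Hence all weights lie in
-- {b,…,b+2n}.

open import Defs
open import Data.Bool using (Bool; true; false; not)
open import Data.Fin using (Fin; zero; suc; toℕ; combine; remQuot; opposite; inject₁)
open import Data.Fin.Patterns
import Data.Fin.Permutation as Permutation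
import Data.Fin.Properties as Fin
open import Data.List
  using (List; []; _∷_; _++_; map; filter; length; allFin; deduplicate; upTo; lookup)
import Data.List.Extrema.Nat as Extrema
open import Data.List.Membership.Propositional using (_∈_)
open import Data.List.Membership.Propositional.Properties
  using (∈-map⁺; ∈-map⁻; ∈-++⁺ˡ; ∈-++⁻; ∈-filter⁺; ∈-filter⁻; ∈-allFin; ∈-upTo⁺; ∈-lookup;
         ∈-deduplicate⁺; ∈-deduplicate⁻)
open import Data.List.Membership.Propositional.Properties.WithK using (unique∧set⇒bag)
open import Data.List.Membership.Setoid.Properties using (index-injective)
open import Data.List.Properties using (length-map; length-tabulate; length-upTo; map-∘)
open import Data.List.Relation.Binary.BagAndSetEquality using (∼bag⇒↭)
open import Data.List.Relation.Binary.Permutation.Propositional using (_↭_; ↭-trans)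
import Data.List.Relation.Binary.Permutation.Propositional.Properties as ↭
open import Data.List.Relation.Unary.All as All using (All; []; _∷_)
open import Data.List.Relation.Unary.AllPairs using ([]; _∷_)
open import Data.List.Relation.Unary.Any as Any using (here; there)
open import Data.List.Relation.Unary.Unique.DecPropositional.Properties
  using (deduplicate-!)
open import Data.List.Relation.Unary.Unique.Propositional using (Unique)
import Data.List.Relation.Unary.Unique.Propositional.Properties as Unique
open import Data.Nat using (ℕ; zero; suc; _+_; _*_; _≤_; _<_; _≟_; s≤s; z≤n; s≤s⁻¹)
open import Data.Nat.ListAction using (sum)
open import Data.Nat.ListAction.Properties using (sum-↭)
open import Data.Nat.Properties
  using (≤-antisym; <⇒≤; *-comm; +-monoʳ-≤; m≤n+m; ≤-trans; ≤-reflexive; +-comm;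
         +-identityʳ; +-cancelˡ-≡; m+[n∸m]≡n; *-monoʳ-≤; <⇒≱; m<m+n; m≤m+n; suc-injective; module
         ≤-Reasoning)
open import Data.Nat.Tactic.RingSolver using (solve-∀)
open import Data.Product using (∃-syntax; _×_; _,_; proj₁; proj₂)
open import Data.Product.Function.NonDependent.Propositional using (_×-↔_)
open import Data.Sum as Sum using (_⊎_; inj₁; inj₂)
open import Data.Sum.Function.Propositional using (_⊎-↔_)
open import Data.Sum.Properties using (inj₁-injective; inj₂-injective)
open import Data.Vec using ([]; _∷_)
import Data.Vec as Vec
open import Function using (_∘_; case_of_)
open import Function.Bundles
  using (_↔_; mk⇔; mk↔ₛ′; module Inverse; module Injection; module Bijection)
open import Function.Construct.Composition using (_↔-∘_)
open import Function.Properties.Inverse using (↔-sym; ↔⇒⤖; ↔⇒↣)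
open import Relation.Binary.PropositionalEquality
open import Relation.Nullary using (contradiction)
open import Relation.Nullary.Decidable using (from-yes; ¬?; _→-dec_)

-- Counting in lists without repetition.

module _ {A : Set} where

  lookup-injective : {xs : List A} → Unique xs → ∀ {i j} → lookup xs i ≡ lookup xs j → i ≡ j
  lookup-injective (_   ∷ _)   {zero}  {zero}  _  = refl
  lookup-injective (x∉  ∷ _)   {zero}  {suc j} eq = contradiction eq (All.lookup x∉ (∈-lookup j))
  lookup-injective (x∉  ∷ _)   {suc i} {zero}  eq = contradiction (sym eq) (All.lookup x∉ (∈-lookup i))
  lookup-injective (_   ∷ xs!) {suc i} {suc j} eq = cong suc (lookup-injective xs! eq)

  -- Pigeonhole: sending each position of `xs` to the position of its entry in `ys` is injective.
  unique∧⊆⇒length≤ : {xs ys : List A} → Unique xs → (∀ {x} → x ∈ xs → x ∈ ys) →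
                     length xs ≤ length ys
  unique∧⊆⇒length≤ xs! xs⊆ys = Fin.injective⇒≤ {f = λ i → Any.index (xs⊆ys (∈-lookup i))}
    λ eq → lookup-injective xs! (index-injective (setoid A) _ _ eq)

  unique∧set⇒↭ : {xs ys : List A} → Unique xs → Unique ys →
                 (∀ {x} → x ∈ xs → x ∈ ys) → (∀ {x} → x ∈ ys → x ∈ xs) → xs ↭ ys
  unique∧set⇒↭ xs! ys! xs⊆ys ys⊆xs = ∼bag⇒↭ (unique∧set⇒bag xs! ys! (mk⇔ xs⊆ys ys⊆xs))

-- The maximum of `x ∷ xs` is exceeded by some entry of `ws`. That entry is new, so adjoining it
-- gives a longer list without repetition, still inside `ws`.
ascent⇒length< : ∀ {x xs ws} → Unique (x ∷ xs) → (∀ {y} → y ∈ x ∷ xs → y ∈ ws) →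
                 (∀ {y} → y ∈ x ∷ xs → ∃[ z ] (z ∈ ws × y < z)) →
                 length (x ∷ xs) < length (deduplicate _≟_ ws)
ascent⇒length< {x} {xs} {ws} xs! ⊆ws ascend =
  unique∧⊆⇒length≤ (All.tabulate (λ y∈ → λ { refl → <⇒≱ top<z (≤top y∈) }) ∷ xs!)
    λ { (here refl) → ∈-deduplicate⁺ _≟_ z∈ws ; (there y∈) → ∈-deduplicate⁺ _≟_ (⊆ws y∈) }
  where
    top : ℕ
    top = Extrema.max x xs

    top∈ : top ∈ x ∷ xs
    top∈ = Sum.[ here , there ]′ (Extrema.argmax-sel (λ y → y) x xs)

    ≤top : ∀ {y} → y ∈ x ∷ xs → y ≤ top
    ≤top (here refl) = Extrema.⊥≤max x xs
    ≤top (there y∈)  = All.lookup (Extrema.xs≤max x xs) y∈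

    z∈ws  = proj₁ (proj₂ (ascend top∈))
    top<z = proj₂ (proj₂ (ascend top∈))

-- Edges at a vertex and the list of all weights.

module _ (G : Graph) where
  open Graph G

  ∈-vertices : ∀ v → v ∈ vertices
  ∈-vertices v = subst (_∈ vertices) (Inverse.strictlyInverseˡ enumV v)
    (∈-map⁺ (Inverse.to enumV) (∈-allFin _))

  ∈-edges : ∀ e → e ∈ edges
  ∈-edges e = subst (_∈ edges) (Inverse.strictlyInverseˡ enumE e)
    (∈-map⁺ (Inverse.to enumE) (∈-allFin _))

  edges! : Unique edges
  edges! = Unique.map⁺ (Injection.injective (↔⇒↣ enumE)) (Unique.allFin⁺ size)

  incidentEdges : V → List E
  incidentEdges u = filter (incident? u) edges

  incidentEdges! : ∀ u → Unique (incidentEdges u)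
  incidentEdges! u = Unique.filter⁺ (incident? u) edges!

  ∈-incidentEdges⁺ : ∀ {u e} → Incident u e → e ∈ incidentEdges u
  ∈-incidentEdges⁺ {u} = ∈-filter⁺ (incident? u) (∈-edges _)

  ∈-incidentEdges⁻ : ∀ {u e} → e ∈ incidentEdges u → Incident u e
  ∈-incidentEdges⁻ {u} = proj₂ ∘ ∈-filter⁻ (incident? u) {xs = edges}

module _ (G : Graph) (f : Labeling G) where
  open Graph G

  weights : List ℕ
  weights = map (weightV G f) vertices ++ map (weightE G f) edges

  weightV∈weights : ∀ v → weightV G f v ∈ weights
  weightV∈weights v = ∈-++⁺ˡ (∈-map⁺ (weightV G f) (∈-vertices G v))

  label-injective : ∀ {x y} → label G f x ≡ label G f y → x ≡ y
  label-injective = Bijection.injective f ∘ Fin.toℕ-injective ∘ suc-injective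

  -- Every distinct weight is one of the `suc k` numbers from `b` to `b + k`; this is how the upper
  -- bound is counted.
  numWeights≤ : ∀ b k → (∀ v → ∃[ t ] (t ≤ k × weightV G f v ≡ b + t)) →
                (∀ e → ∃[ t ] (t ≤ k × weightE G f e ≡ b + t)) → numWeights G f ≤ suc k
  numWeights≤ b k inRangeV inRangeE = ≤-trans
    (unique∧⊆⇒length≤ (deduplicate-! _≟_ weights) (weights⊆ ∘ ∈-deduplicate⁻ _≟_ weights))
    (≤-reflexive (trans (length-map (b +_) (upTo (suc k))) (length-upTo (suc k))))
    where
      range : List ℕ
      range = map (b +_) (upTo (suc k))

      ∈-range : ∀ {w} → ∃[ t ] (t ≤ k × w ≡ b + t) → w ∈ range
      ∈-range (_ , t≤k , refl) = ∈-map⁺ (b +_) (∈-upTo⁺ (s≤s t≤k))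

      weights⊆ : ∀ {w} → w ∈ weights → w ∈ range
      weights⊆ w∈ with ∈-++⁻ (map (weightV G f) vertices) w∈
      ... | inj₁ w∈V = case ∈-map⁻ (weightV G f) w∈V of λ { (v , _ , refl) → ∈-range (inRangeV v) }
      ... | inj₂ w∈E = case ∈-map⁻ (weightE G f) w∈E of λ { (e , _ , refl) → ∈-range (inRangeE e) }

-- Incident edges in disjoint unions.

module _ (H G : Graph) where
  private
    module G = Graph G
    module H = Graph H

  -- φ and ψ embed G as a union of components of H.
  incidentEdges-embed : (φ : G.V → H.V) (ψ : G.E → H.E) →
    (∀ {e e′} → ψ e ≡ ψ e′ → e ≡ e′) →
    (∀ {u e} → G.Incident u e → H.Incident (φ u) (ψ e)) →
    (∀ {u e′} → H.Incident (φ u) e′ → ∃[ e ] (e′ ≡ ψ e × G.Incident u e)) →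
    ∀ u → incidentEdges H (φ u) ↭ map ψ (incidentEdges G u)
  incidentEdges-embed φ ψ ψ-injective preserves reflects u =
    unique∧set⇒↭ (incidentEdges! H (φ u)) (Unique.map⁺ ψ-injective (incidentEdges! G u)) to from
    where
      to : ∀ {e′} → e′ ∈ incidentEdges H (φ u) → e′ ∈ map ψ (incidentEdges G u)
      to e′∈ with reflects (∈-incidentEdges⁻ H e′∈)
      ... | _ , refl , inc = ∈-map⁺ ψ (∈-incidentEdges⁺ G inc)

      from : ∀ {e′} → e′ ∈ map ψ (incidentEdges G u) → e′ ∈ incidentEdges H (φ u)
      from e′∈ with ∈-map⁻ ψ e′∈
      ... | _ , e∈ , refl = ∈-incidentEdges⁺ H (preserves (∈-incidentEdges⁻ G e∈))

incidentEdges-⊕ˡ : ∀ G H u → incidentEdges (G ⊕ H) (inj₁ u) ↭ map inj₁ (incidentEdges G u)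
incidentEdges-⊕ˡ G H = incidentEdges-embed (G ⊕ H) G inj₁ inj₁ inj₁-injective
  (Sum.map (cong inj₁) (cong inj₁)) reflects
  where
    reflects : ∀ {u e′} → Graph.Incident (G ⊕ H) (inj₁ u) e′ →
               ∃[ e ] (e′ ≡ inj₁ e × Graph.Incident G u e)
    reflects {e′ = inj₁ e} inc = e , refl , Sum.map inj₁-injective inj₁-injective inc
    reflects {e′ = inj₂ _} (inj₁ ())
    reflects {e′ = inj₂ _} (inj₂ ())

incidentEdges-⊕ʳ : ∀ G H u → incidentEdges (G ⊕ H) (inj₂ u) ↭ map inj₂ (incidentEdges H u)
incidentEdges-⊕ʳ G H = incidentEdges-embed (G ⊕ H) H inj₂ inj₂ inj₂-injective
  (Sum.map (cong inj₂) (cong inj₂)) reflects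
  where
    reflects : ∀ {u e′} → Graph.Incident (G ⊕ H) (inj₂ u) e′ →
               ∃[ e ] (e′ ≡ inj₂ e × Graph.Incident H u e)
    reflects {e′ = inj₂ e} inc = e , refl , Sum.map inj₂-injective inj₂-injective inc
    reflects {e′ = inj₁ _} (inj₁ ())
    reflects {e′ = inj₁ _} (inj₂ ())

incidentEdges-· : ∀ m G i u → incidentEdges (m · G) (i , u) ↭ map (i ,_) (incidentEdges G u)
incidentEdges-· m G i = incidentEdges-embed (m · G) G (i ,_) (i ,_) (cong proj₂)
  (Sum.map (cong (i ,_)) (cong (i ,_))) reflects
  where
    reflects : ∀ {u e′} → Graph.Incident (m · G) (i , u) e′ →
               ∃[ e ] (e′ ≡ (i , e) × Graph.Incident G u e)
    reflects {e′ = _ , e} (inj₁ refl) = e , refl , inj₁ refl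
    reflects {e′ = _ , e} (inj₂ refl) = e , refl , inj₂ refl

-- Proper total colourings.

record IsProper (G : Graph) {K : Set} (cV : Graph.V G → K) (cE : Graph.E G → K) : Set where
  open Graph G
  field
    ends        : ∀ e → cV (src e) ≢ cV (tgt e)
    edge-edge   : ∀ v e e′ → Incident v e → Incident v e′ → cE e ≡ cE e′ → e ≡ e′
    vertex-edge : ∀ v e → Incident v e → cV v ≢ cE e

open IsProper

module _ {G : Graph} where
  open Graph G

  -- A collision of `d`-values would be a collision of `c`-values. Below, `d` is the weight and `c`
  -- one of three colours, so properness has to be checked for the colours only.
  IsProper-refine : ∀ {K L : Set} {cV : V → K} {cE : E → K} {dV : V → L} {dE : E → L} →
    (∀ u v → dV u ≡ dV v → cV u ≡ cV v) → (∀ e e′ → dE e ≡ dE e′ → cE e ≡ cE e′) →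
    (∀ v e → dV v ≡ dE e → cV v ≡ cE e) → IsProper G cV cE → IsProper G dV dE
  IsProper-refine vv ee ve p = record
    { ends        = λ e → ends p e ∘ vv _ _
    ; edge-edge   = λ v e e′ i i′ → edge-edge p v e e′ i i′ ∘ ee e e′
    ; vertex-edge = λ v e i → vertex-edge p v e i ∘ ve v e
    }

  isLocalTotalAntimagic : ∀ f → IsProper G (weightV G f) (weightE G f) →
                          IsLocalTotalAntimagic G f
  isLocalTotalAntimagic f p = record
    { vertex-vertex = λ where
        _ _ (e , inj₁ (refl , refl)) → ends p e
        _ _ (e , inj₂ (refl , refl)) → ends p e ∘ sym
    ; edge-edge     = λ e e′ (e≢e′ , v , i , i′) → e≢e′ ∘ edge-edge p v e e′ i i′
    ; vertex-edge   = vertex-edge p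
    }

-- No incidence crosses between the two summands, so properness is local to each, even when both use
-- the same colours.
IsProper-⊕ : ∀ {G H K} {cV : Graph.V (G ⊕ H) → K} {cE : Graph.E (G ⊕ H) → K} →
  IsProper G (cV ∘ inj₁) (cE ∘ inj₁) → IsProper H (cV ∘ inj₂) (cE ∘ inj₂) →
  IsProper (G ⊕ H) cV cE
IsProper-⊕ {G} {H} p q = record
  { ends        = λ { (inj₁ e) → ends p e ; (inj₂ e) → ends q e }
  ; edge-edge   = λ where
      (inj₁ v) (inj₁ e) (inj₁ e′) i i′ eq → cong inj₁
        (edge-edge p v e e′ (drop₁ i) (drop₁ i′) eq)
      (inj₂ v) (inj₂ e) (inj₂ e′) i i′ eq → cong inj₂
        (edge-edge q v e e′ (drop₂ i) (drop₂ i′) eq)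
      (inj₁ _) (inj₁ _) (inj₂ _) _ (inj₁ ()) _
      (inj₁ _) (inj₁ _) (inj₂ _) _ (inj₂ ()) _
      (inj₁ _) (inj₂ _) _ (inj₁ ()) _ _
      (inj₁ _) (inj₂ _) _ (inj₂ ()) _ _
      (inj₂ _) (inj₂ _) (inj₁ _) _ (inj₁ ()) _
      (inj₂ _) (inj₂ _) (inj₁ _) _ (inj₂ ()) _
      (inj₂ _) (inj₁ _) _ (inj₁ ()) _ _
      (inj₂ _) (inj₁ _) _ (inj₂ ()) _ _
  ; vertex-edge = λ where
      (inj₁ v) (inj₁ e) i → vertex-edge p v e (drop₁ i)
      (inj₂ v) (inj₂ e) i → vertex-edge q v e (drop₂ i)
      (inj₁ _) (inj₂ _) (inj₁ ())
      (inj₁ _) (inj₂ _) (inj₂ ())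
      (inj₂ _) (inj₁ _) (inj₁ ())
      (inj₂ _) (inj₁ _) (inj₂ ())
  }
  where
    drop₁ : ∀ {v e} → Graph.Incident (G ⊕ H) (inj₁ v) (inj₁ e) → Graph.Incident G v e
    drop₁ = Sum.map inj₁-injective inj₁-injective

    drop₂ : ∀ {v e} → Graph.Incident (G ⊕ H) (inj₂ v) (inj₂ e) → Graph.Incident H v e
    drop₂ = Sum.map inj₂-injective inj₂-injective

IsProper-· : ∀ {m G K} {cV : Graph.V (m · G) → K} {cE : Graph.E (m · G) → K} →
  (∀ i → IsProper G (cV ∘ (i ,_)) (cE ∘ (i ,_))) → IsProper (m · G) cV cE
IsProper-· {m} {G} p = record
  { ends        = λ (i , e) → ends (p i) e
  ; edge-edge   = λ { (i , v) (j , e) (k , e′) x y eq →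
      case copy x , copy y of λ { (refl , refl) →
        cong (i ,_) (edge-edge (p i) v e e′ (drop x) (drop y) eq) } }
  ; vertex-edge = λ { (i , v) (j , e) x →
      case copy x of λ { refl → vertex-edge (p i) v e (drop x) } }
  }
  where
    copy : ∀ {i j v e} → Graph.Incident (m · G) (i , v) (j , e) → i ≡ j
    copy = Sum.[ sym ∘ cong proj₁ , sym ∘ cong proj₁ ]

    drop : ∀ {i j v e} → Graph.Incident (m · G) (i , v) (j , e) → Graph.Incident G v e
    drop = Sum.map (cong proj₂) (cong proj₂)

-- Total colourings of `C 6` and `P 6` with three colours.

vertexColour : Fin 6 → Fin 3
vertexColour = Vec.lookup (1F ∷ 2F ∷ 0F ∷ 1F ∷ 2F ∷ 0F ∷ [])

-- From vertex 0 onwards, vertices and edges alternating, the colours run 1, 0, 2, 1, 0, 2 and so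
-- on. Any three consecutive elements differ, which is properness, and the pattern closes up because
-- 3 divides 12.
edgeColourC : Fin 6 → Fin 3
edgeColourC = Vec.lookup (2F ∷ 0F ∷ 1F ∷ 2F ∷ 0F ∷ 1F ∷ [])

-- The path is the cycle without its edge 0, so the remaining edges keep their colours with indices
-- shifted by one.
edgeColourP : Fin 5 → Fin 3
edgeColourP = Vec.lookup (0F ∷ 1F ∷ 2F ∷ 0F ∷ 1F ∷ [])

isProper-C₆ : IsProper (C 6) vertexColour edgeColourC
isProper-C₆ = record
  { ends        = from-yes (Fin.all? λ e → ¬? (vertexColour (src e) Fin.≟ vertexColour (tgt e)))
  ; edge-edge   = from-yes (Fin.all? λ v → Fin.all? λ e → Fin.all? λ e′ →
      incident? v e →-dec incident? v e′ →-dec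
      (edgeColourC e Fin.≟ edgeColourC e′) →-dec (e Fin.≟ e′))
  ; vertex-edge = from-yes (Fin.all? λ v → Fin.all? λ e →
      incident? v e →-dec ¬? (vertexColour v Fin.≟ edgeColourC e))
  }
  where open Graph (C 6)

isProper-P₆ : IsProper (P 6) vertexColour edgeColourP
isProper-P₆ = record
  { ends        = from-yes (Fin.all? λ e → ¬? (vertexColour (src e) Fin.≟ vertexColour (tgt e)))
  ; edge-edge   = from-yes (Fin.all? λ v → Fin.all? λ e → Fin.all? λ e′ →
      incident? v e →-dec incident? v e′ →-dec
      (edgeColourP e Fin.≟ edgeColourP e′) →-dec (e Fin.≟ e′))
  ; vertex-edge = from-yes (Fin.all? λ v → Fin.all? λ e →
      incident? v e →-dec ¬? (vertexColour v Fin.≟ edgeColourP e))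
  }
  where open Graph (P 6)

-- Reversal of blocks.

toℕ+opposite : ∀ {n} (i : Fin n) → suc (toℕ i + toℕ (opposite i)) ≡ n
toℕ+opposite i = trans (cong (suc (toℕ i) +_) (Fin.opposite-prop i)) (m+[n∸m]≡n (Fin.toℕ<n i))

reverseIf : ∀ {n} → Bool → Fin n → Fin n
reverseIf true  = opposite
reverseIf false = λ i → i

reverseIf-involutive : ∀ {n} b (i : Fin n) → reverseIf b (reverseIf b i) ≡ i
reverseIf-involutive true  = Fin.opposite-involutive
reverseIf-involutive false = λ _ → refl

-- Of the two entries exactly one is reversed, so their sum does not depend on `i`; this makes
-- weights agree across all copies of `P 6`.
reverseIf-complementary : ∀ {n} b (i : Fin n) →
  suc (toℕ (reverseIf b i) + toℕ (reverseIf (not b) i)) ≡ n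
reverseIf-complementary true  i = trans (cong suc (+-comm (toℕ (opposite i)) _)) (toℕ+opposite i)
reverseIf-complementary false i = toℕ+opposite i

reverseRows : ∀ {k n} → (Fin k → Bool) → (Fin k × Fin n) ↔ (Fin k × Fin n)
reverseRows b = mk↔ₛ′ reverse reverse reverse-involutive reverse-involutive
  where
    reverse = λ (k , i) → k , reverseIf (b k) i
    reverse-involutive = λ (k , i) → cong (k ,_) (reverseIf-involutive (b k) i)

-- The labelling and its pairwise label sums.

module _ (m n : ℕ) where

  G : Graph
  G = m · C 6 ⊕ n · P 6

  open Graph G

  Slot : Set
  Slot = (Fin 5 × Fin n) ⊎ (Fin m × Fin 6) ⊎ (Fin m × Fin 6) ⊎ (Fin 6 × Fin n)

  pattern low  k j = inj₁ (k , j)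
  pattern midl i r = inj₂ (inj₁ (i , r))
  pattern midr i r = inj₂ (inj₂ (inj₁ (i , r)))
  pattern high k j = inj₂ (inj₂ (inj₂ (k , j)))

  -- In increasing order the labels form five blocks of n labels, two blocks of 6m
  -- and six blocks of n. The j-th P₆ takes from each n-block the j-th label, or the
  -- j-th from the end if the block is marked as reversed; the i-th C₆ takes six
  -- consecutive labels from the first 6m-block and the mirror images of these from
  -- the second.
  slot : V ⊎ E → Slot
  slot (inj₁ (inj₁ (i , 0F))) = midl i 4F
  slot (inj₁ (inj₁ (i , 1F))) = midr i 5F
  slot (inj₁ (inj₁ (i , 2F))) = midl i 5F
  slot (inj₁ (inj₁ (i , 3F))) = midr i 4F
  slot (inj₁ (inj₁ (i , 4F))) = midl i 3F
  slot (inj₁ (inj₁ (i , 5F))) = midr i 3F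
  slot (inj₁ (inj₂ (j , 0F))) = low  3F j
  slot (inj₁ (inj₂ (j , 1F))) = high 0F j
  slot (inj₁ (inj₂ (j , 2F))) = low  4F j
  slot (inj₁ (inj₂ (j , 3F))) = high 1F j
  slot (inj₁ (inj₂ (j , 4F))) = low  2F j
  slot (inj₁ (inj₂ (j , 5F))) = high 2F j
  slot (inj₂ (inj₁ (i , 0F))) = midl i 0F
  slot (inj₂ (inj₁ (i , 1F))) = midr i 0F
  slot (inj₂ (inj₁ (i , 2F))) = midl i 1F
  slot (inj₂ (inj₁ (i , 3F))) = midr i 2F
  slot (inj₂ (inj₁ (i , 4F))) = midl i 2F
  slot (inj₂ (inj₁ (i , 5F))) = midr i 1F
  slot (inj₂ (inj₂ (j , 0F))) = high 5F j
  slot (inj₂ (inj₂ (j , 1F))) = low  0F j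
  slot (inj₂ (inj₂ (j , 2F))) = high 3F j
  slot (inj₂ (inj₂ (j , 3F))) = low  1F j
  slot (inj₂ (inj₂ (j , 4F))) = high 4F j

  -- The preimages given here also serve as the inverse map `unslot`.
  slot-surjective : ∀ s → ∃[ x ] slot x ≡ s
  slot-surjective (low  0F j) = inj₂ (inj₂ (j , 1F)) , refl
  slot-surjective (low  1F j) = inj₂ (inj₂ (j , 3F)) , refl
  slot-surjective (low  2F j) = inj₁ (inj₂ (j , 4F)) , refl
  slot-surjective (low  3F j) = inj₁ (inj₂ (j , 0F)) , refl
  slot-surjective (low  4F j) = inj₁ (inj₂ (j , 2F)) , refl
  slot-surjective (midl i 0F) = inj₂ (inj₁ (i , 0F)) , refl
  slot-surjective (midl i 1F) = inj₂ (inj₁ (i , 2F)) , refl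
  slot-surjective (midl i 2F) = inj₂ (inj₁ (i , 4F)) , refl
  slot-surjective (midl i 3F) = inj₁ (inj₁ (i , 4F)) , refl
  slot-surjective (midl i 4F) = inj₁ (inj₁ (i , 0F)) , refl
  slot-surjective (midl i 5F) = inj₁ (inj₁ (i , 2F)) , refl
  slot-surjective (midr i 0F) = inj₂ (inj₁ (i , 1F)) , refl
  slot-surjective (midr i 1F) = inj₂ (inj₁ (i , 5F)) , refl
  slot-surjective (midr i 2F) = inj₂ (inj₁ (i , 3F)) , refl
  slot-surjective (midr i 3F) = inj₁ (inj₁ (i , 5F)) , refl
  slot-surjective (midr i 4F) = inj₁ (inj₁ (i , 3F)) , refl
  slot-surjective (midr i 5F) = inj₁ (inj₁ (i , 1F)) , refl
  slot-surjective (high 0F j) = inj₁ (inj₂ (j , 1F)) , refl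
  slot-surjective (high 1F j) = inj₁ (inj₂ (j , 3F)) , refl
  slot-surjective (high 2F j) = inj₁ (inj₂ (j , 5F)) , refl
  slot-surjective (high 3F j) = inj₂ (inj₂ (j , 2F)) , refl
  slot-surjective (high 4F j) = inj₂ (inj₂ (j , 4F)) , refl
  slot-surjective (high 5F j) = inj₂ (inj₂ (j , 0F)) , refl

  unslot : Slot → V ⊎ E
  unslot = proj₁ ∘ slot-surjective

  unslot∘slot : ∀ x → unslot (slot x) ≡ x
  unslot∘slot (inj₁ (inj₁ (_ , 0F))) = refl
  unslot∘slot (inj₁ (inj₁ (_ , 1F))) = refl
  unslot∘slot (inj₁ (inj₁ (_ , 2F))) = refl
  unslot∘slot (inj₁ (inj₁ (_ , 3F))) = refl
  unslot∘slot (inj₁ (inj₁ (_ , 4F))) = refl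
  unslot∘slot (inj₁ (inj₁ (_ , 5F))) = refl
  unslot∘slot (inj₁ (inj₂ (_ , 0F))) = refl
  unslot∘slot (inj₁ (inj₂ (_ , 1F))) = refl
  unslot∘slot (inj₁ (inj₂ (_ , 2F))) = refl
  unslot∘slot (inj₁ (inj₂ (_ , 3F))) = refl
  unslot∘slot (inj₁ (inj₂ (_ , 4F))) = refl
  unslot∘slot (inj₁ (inj₂ (_ , 5F))) = refl
  unslot∘slot (inj₂ (inj₁ (_ , 0F))) = refl
  unslot∘slot (inj₂ (inj₁ (_ , 1F))) = refl
  unslot∘slot (inj₂ (inj₁ (_ , 2F))) = refl
  unslot∘slot (inj₂ (inj₁ (_ , 3F))) = refl
  unslot∘slot (inj₂ (inj₁ (_ , 4F))) = refl
  unslot∘slot (inj₂ (inj₁ (_ , 5F))) = refl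
  unslot∘slot (inj₂ (inj₂ (_ , 0F))) = refl
  unslot∘slot (inj₂ (inj₂ (_ , 1F))) = refl
  unslot∘slot (inj₂ (inj₂ (_ , 2F))) = refl
  unslot∘slot (inj₂ (inj₂ (_ , 3F))) = refl
  unslot∘slot (inj₂ (inj₂ (_ , 4F))) = refl

  -- On each path, labels that are added come from one low and one high block, both of vertices or
  -- both of edges. Reversed are the low edge blocks and the high vertex blocks, so exactly one
  -- block of each pair is reversed, while the pendant labels increase with `j`.
  lowReversed : Fin 5 → Bool
  lowReversed = Vec.lookup (true ∷ true ∷ false ∷ false ∷ false ∷ [])

  highReversed : Fin 6 → Bool
  highReversed = Vec.lookup (true ∷ true ∷ true ∷ false ∷ false ∷ false ∷ [])

  slots≡order+size : 5 * n + (m * 6 + (m * 6 + 6 * n)) ≡ order + size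
  slots≡order+size = count m n
    where
      count : ∀ m n → 5 * n + (m * 6 + (m * 6 + 6 * n)) ≡ m * 6 + n * 6 + (m * 6 + n * 5)
      count = solve-∀

  slotIndex : Slot ↔ Fin (order + size)
  slotIndex =
    Permutation.cast-id slots≡order+size ↔-∘
    join ((↔-sym Fin.*↔× ↔-∘ reverseRows lowReversed) ⊎-↔
    join (↔-sym Fin.*↔× ⊎-↔
    -- Reversing both coordinates reverses the whole block of 6m labels, so `midr i r` is the mirror
    -- image of `midl i r`.
    join ((↔-sym Fin.*↔× ↔-∘ (Permutation.reverse ×-↔ Permutation.reverse)) ⊎-↔
          (↔-sym Fin.*↔× ↔-∘ reverseRows highReversed))))
    where
      join : ∀ {a b} {A : Set} → A ↔ (Fin a ⊎ Fin b) → A ↔ Fin (a + b)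
      join A↔ = ↔-sym Fin.+↔⊎ ↔-∘ A↔

  value : Slot → ℕ
  value (low  k j) = n * toℕ k + toℕ (reverseIf (lowReversed k) j)
  value (midl i r) = 5 * n + (6 * toℕ i + toℕ r)
  value (midr i r) = 5 * n + (m * 6 + (6 * toℕ (opposite i) + toℕ (opposite r)))
  value (high k j) = 5 * n + (m * 6 + (m * 6 + (n * toℕ k + toℕ (reverseIf (highReversed k) j))))

  toℕ-slotIndex : ∀ s → toℕ (Inverse.to slotIndex s) ≡ value s
  toℕ-slotIndex (low k j) = trans (Fin.toℕ-cast slots≡order+size _)
    (trans (Fin.toℕ-↑ˡ (combine k j′) _) (Fin.toℕ-combine k j′))
    where j′ = reverseIf (lowReversed k) j
  toℕ-slotIndex (midl i r) = trans (Fin.toℕ-cast slots≡order+size _)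
    (trans (Fin.toℕ-↑ʳ (5 * n) _) (cong (5 * n +_)
    (trans (Fin.toℕ-↑ˡ (combine i r) _) (Fin.toℕ-combine i r))))
  toℕ-slotIndex (midr i r) = trans (Fin.toℕ-cast slots≡order+size _)
    (trans (Fin.toℕ-↑ʳ (5 * n) _) (cong (5 * n +_)
    (trans (Fin.toℕ-↑ʳ (m * 6) _) (cong (m * 6 +_)
    (trans (Fin.toℕ-↑ˡ (combine (opposite i) (opposite r)) _)
           (Fin.toℕ-combine (opposite i) (opposite r)))))))
  toℕ-slotIndex (high k j) = trans (Fin.toℕ-cast slots≡order+size _)
    (trans (Fin.toℕ-↑ʳ (5 * n) _) (cong (5 * n +_)
    (trans (Fin.toℕ-↑ʳ (m * 6) _) (cong (m * 6 +_)
    (trans (Fin.toℕ-↑ʳ (m * 6) _) (cong (m * 6 +_)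
    (Fin.toℕ-combine k (reverseIf (highReversed k) j))))))))

  labeling : Labeling G
  labeling = ↔⇒⤖ (slotIndex ↔-∘ mk↔ₛ′ slot unslot (proj₂ ∘ slot-surjective) unslot∘slot)

  label-value : ∀ x → label G labeling x ≡ suc (value (slot x))
  label-value x = cong suc (toℕ-slotIndex (slot x))

  base : ℕ
  base = 12 * m + 9 * n + 1

  -- Mirror images have the constant label sum 12m + 10n + 1, and replacing `r` by `r′` on one side
  -- changes it by r - r′. The hypothesis says c = 1 + r - r′ without subtraction.
  midl+midr : ∀ i r r′ {c} → toℕ r + toℕ (opposite {6} r′) ≡ 4 + c →
              suc (value (midl i r)) + suc (value (midr i r′)) ≡ 12 * m + 10 * n + c
  midl+midr i r r′ eq = identity m n (toℕ i) _ (toℕ r) _ _ (toℕ+opposite i) eq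
    where
      identity₀ : ∀ n x y r r′ →
        suc (5 * n + (6 * x + r)) + suc (5 * n + (suc (x + y) * 6 + (6 * y + r′))) ≡
        12 * (x + y) + 10 * n + 8 + (r + r′)
      identity₀ = solve-∀

      identity₁ : ∀ n x y c →
        12 * (x + y) + 10 * n + 8 + (4 + c) ≡ 12 * suc (x + y) + 10 * n + c
      identity₁ = solve-∀

      identity : ∀ m n x y r r′ c → suc (x + y) ≡ m → r + r′ ≡ 4 + c →
        suc (5 * n + (6 * x + r)) + suc (5 * n + (m * 6 + (6 * y + r′))) ≡
        12 * m + 10 * n + c
      -- Here `m` becomes `suc (x + y)`, with `x` and `y` the values of `i` and `opposite i`, so
      -- that the ring identities involve no subtraction.
      identity _ n x y r r′ c refl eq = trans (identity₀ n x y r r′)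
        (trans (cong (12 * (x + y) + 10 * n + 8 +_) eq) (identity₁ n x y c))

  -- As exactly one of the two blocks is reversed, the offsets inside them add up to n - 1 for every
  -- `j`; only the block indices remain, contributing a multiple of n.
  low+high : ∀ j k k′ {c} → toℕ k + toℕ k′ ≡ 3 + c → highReversed k′ ≡ not (lowReversed k) →
             suc (value (low k j)) + suc (value (high k′ j)) ≡ base + n * c
  low+high j k k′ {c} eq rev rewrite rev =
    identity m n (toℕ (reverseIf (lowReversed k) j)) _ (toℕ k) (toℕ k′) c
      (reverseIf-complementary (lowReversed k) j) eq
    where
      identity₀ : ∀ m n x y k k′ →
        suc (n * k + x) + suc (5 * n + (m * 6 + (m * 6 + (n * k′ + y)))) ≡
        12 * m + 5 * n + 1 + n * (k + k′) + suc (x + y)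
      identity₀ = solve-∀

      identity₁ : ∀ m n c →
        12 * m + 5 * n + 1 + n * (3 + c) + n ≡ 12 * m + 9 * n + 1 + n * c
      identity₁ = solve-∀

      identity : ∀ m n x y k k′ c → suc (x + y) ≡ n → k + k′ ≡ 3 + c →
        suc (n * k + x) + suc (5 * n + (m * 6 + (m * 6 + (n * k′ + y)))) ≡
        12 * m + 9 * n + 1 + n * c
      identity m n x y k k′ c x+y k+k′ = trans (identity₀ m n x y k k′)
        (trans (cong₂ (λ a b → 12 * m + 5 * n + 1 + n * a + b) k+k′ x+y) (identity₁ m n c))

  -- Vertex weights of an arbitrary labelling.

  module _ (f : Labeling G) where

    -- The edges at a vertex are those of its own component. For a concrete `t` the list
    -- `incidentEdges (C 6) t` computes, which the list in `G` does not.
    weightV-C₆ : ∀ i t → weightV G f (inj₁ (i , t)) ≡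
      sum (map (λ e → label G f (inj₂ (inj₁ (i , e)))) (incidentEdges (C 6) t))
    weightV-C₆ i t = trans
      (sum-↭ (↭.map⁺ (label G f ∘ inj₂) (↭-trans (incidentEdges-⊕ˡ (m · C 6) (n · P 6) (i , t))
        (↭.map⁺ inj₁ (incidentEdges-· m (C 6) i t)))))
      (cong sum (sym (trans (map-∘ es) (map-∘ (map (i ,_) es)))))
      where es = incidentEdges (C 6) t

    weightV-P₆ : ∀ j t → weightV G f (inj₂ (j , t)) ≡
      sum (map (λ e → label G f (inj₂ (inj₂ (j , e)))) (incidentEdges (P 6) t))
    weightV-P₆ j t = trans
      (sum-↭ (↭.map⁺ (label G f ∘ inj₂) (↭-trans (incidentEdges-⊕ʳ (m · C 6) (n · P 6) (j , t))
        (↭.map⁺ inj₂ (incidentEdges-· n (P 6) j t)))))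
      (cong sum (sym (trans (map-∘ es) (map-∘ (map (j ,_) es)))))
      where es = incidentEdges (P 6) t

    -- Pendant edges of the paths.

    pendant : Fin 2 × Fin n → E
    pendant (0F , j) = inj₂ (j , 0F)
    pendant (1F , j) = inj₂ (j , 4F)

    pendant-injective : ∀ {x y} → pendant x ≡ pendant y → x ≡ y
    pendant-injective {0F , _} {0F , _} refl = refl
    pendant-injective {0F , _} {1F , _} ()
    pendant-injective {1F , _} {0F , _} ()
    pendant-injective {1F , _} {1F , _} refl = refl

    pendantLabels : List ℕ
    pendantLabels = map (label G f ∘ inj₂ ∘ pendant ∘ remQuot n) (allFin (2 * n))

    pendantLabels! : Unique pendantLabels
    pendantLabels! = Unique.map⁺
      (Injection.injective (↔⇒↣ Fin.*↔×) ∘ pendant-injective ∘ inj₂-injective ∘ label-injective G f)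
      (Unique.allFin⁺ (2 * n))

    leaf-weight : ∀ x → label G f (inj₂ (pendant x)) ∈ weights G f
    leaf-weight (0F , j) = subst (_∈ weights G f) (trans (weightV-P₆ j 0F) (+-identityʳ _))
      (weightV∈weights G f (inj₂ (j , 0F)))
    leaf-weight (1F , j) = subst (_∈ weights G f) (trans (weightV-P₆ j 5F) (+-identityʳ _))
      (weightV∈weights G f (inj₂ (j , 5F)))

    support-weight : ∀ x → ∃[ z ] (z ∈ weights G f × label G f (inj₂ (pendant x)) < z)
    -- Labels start at 1, so the second edge at the neighbour of a leaf makes its weight strictly
    -- larger than the pendant label.
    support-weight (0F , j) = _ , weightV∈weights G f (inj₂ (j , 1F)) ,
      ≤-trans (m<m+n _ (s≤s z≤n)) (≤-reflexive (sym (weightV-P₆ j 1F)))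
    support-weight (1F , j) = _ , weightV∈weights G f (inj₂ (j , 4F)) ,
      ≤-trans (s≤s (≤-trans (m≤m+n _ 0) (m≤n+m _ _))) (≤-reflexive (sym (weightV-P₆ j 4F)))

    pendantLabels⊆weights : ∀ {w} → w ∈ pendantLabels → w ∈ weights G f
    pendantLabels⊆weights w∈ with ∈-map⁻ (label G f ∘ inj₂ ∘ pendant ∘ remQuot n) w∈
    ... | k , _ , refl = leaf-weight (remQuot n k)

    pendantLabels-ascend : ∀ {w} → w ∈ pendantLabels → ∃[ z ] (z ∈ weights G f × w < z)
    pendantLabels-ascend w∈ with ∈-map⁻ (label G f ∘ inj₂ ∘ pendant ∘ remQuot n) w∈
    ... | k , _ , refl = support-weight (remQuot n k)

module _ (m n′ : ℕ) where
  private
    n = suc n′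
    H = G m n
    f₀ = labeling m n
    b = base m n

  open Graph H

  -- The lower bound.

  numWeights-lower : ∀ f → 2 * n + 1 ≤ numWeights H f
  numWeights-lower f = ≤-trans
    (≤-reflexive (trans (+-comm (2 * n) 1) (cong suc (sym
      (trans (length-map _ (allFin (2 * n))) (length-tabulate {n = 2 * n} (λ i → i)))))))
    -- Since `n` is `suc n′`, the list `pendantLabels` reduces to a cons and so has a maximum.
    (ascent⇒length< (pendantLabels! m n f) (pendantLabels⊆weights m n f)
      (pendantLabels-ascend m n f))

  -- Weights of the constructed labelling.

  cycleWeight : Fin 3 → ℕ
  cycleWeight c = 12 * m + 10 * n + toℕ c

  -- The excess over `b` is n c + d with d < n, so the colour `c` is its quotient by n and can be
  -- read off the weight.
  pathWeight : Fin 3 → Fin n → ℕ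
  pathWeight c d = b + toℕ (combine c d)

  -- Nonzero at most at the two leaves, where it makes up for the deleted edge label -j.
  slack : Fin n → Fin 6 → Fin n
  slack j = Vec.lookup (j ∷ 0F ∷ 0F ∷ 0F ∷ 0F ∷ j ∷ [])

  label+label : ∀ x y {s s′} → slot m n x ≡ s → slot m n y ≡ s′ →
    label H f₀ x + label H f₀ y ≡ suc (value m n s) + suc (value m n s′)
  label+label x y refl refl = cong₂ _+_ (label-value m n x) (label-value m n y)

  cycle+ : ∀ x y {i r r′ c} → slot m n x ≡ midl i r → slot m n y ≡ midr i r′ →
    toℕ r + toℕ (opposite r′) ≡ 4 + toℕ c → label H f₀ x + label H f₀ y ≡ cycleWeight c
  cycle+ x y {i} {r} {r′} p q eq = trans (label+label x y p q) (midl+midr m n i r r′ eq)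

  path+ : ∀ x y {j k k′ c} → slot m n x ≡ low k j → slot m n y ≡ high k′ j →
    toℕ k + toℕ k′ ≡ 3 + toℕ c → highReversed m n k′ ≡ not (lowReversed m n k) →
    label H f₀ x + label H f₀ y ≡ pathWeight c 0F
  path+ x y {j} {k} {k′} {c} p q eq rev = trans (label+label x y p q)
    (trans (low+high m n j k k′ eq rev) (cong (b +_) (sym (trans (Fin.toℕ-combine c 0F) (+-identityʳ _)))))

  -- The pendant edges lie in the unreversed blocks `high 4F` and `high 5F`, which are the cases c =
  -- 0 and c = 1.
  leaf-label : ∀ j c → suc (5 * n + (m * 6 + (m * 6 + (n * (4 + toℕ c) + toℕ j)))) ≡ pathWeight c j
  leaf-label j c = trans (identity m n (toℕ c) (toℕ j)) (cong (b +_) (sym (Fin.toℕ-combine c j)))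
    where
      identity : ∀ m n c j → suc (5 * n + (m * 6 + (m * 6 + (n * (4 + c) + j)))) ≡
                             12 * m + 9 * n + 1 + (n * c + j)
      identity = solve-∀

  label-comm : ∀ x y {w} → label H f₀ x + label H f₀ y ≡ w → label H f₀ y + label H f₀ x ≡ w
  label-comm x y = trans (+-comm (label H f₀ y) (label H f₀ x))

  sum₂ : ∀ {A : Set} (g : A → ℕ) x y {w} → g x + g y ≡ w → sum (map g (x ∷ y ∷ [])) ≡ w
  sum₂ g x y = trans (cong (g x +_) (+-identityʳ (g y)))

  weightV-cycle : ∀ i t → weightV H f₀ (inj₁ (i , t)) ≡ cycleWeight (vertexColour t)
  weightV-cycle i t = trans (weightV-C₆ m n f₀ i t) (pair t)
    where
      e : Fin 6 → V ⊎ E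
      e t = inj₂ (inj₁ (i , t))

      pair : ∀ t → sum (map (label H f₀ ∘ e) (incidentEdges (C 6) t)) ≡ cycleWeight (vertexColour t)
      pair 0F = sum₂ (label H f₀ ∘ e) 0F 1F
        (cycle+ (e 0F) (e 1F) refl refl refl)
      pair 1F = sum₂ (label H f₀ ∘ e) 1F 2F
        (label-comm (e 2F) (e 1F) (cycle+ (e 2F) (e 1F) refl refl refl))
      pair 2F = sum₂ (label H f₀ ∘ e) 2F 3F
        (cycle+ (e 2F) (e 3F) refl refl refl)
      pair 3F = sum₂ (label H f₀ ∘ e) 3F 4F
        (label-comm (e 4F) (e 3F) (cycle+ (e 4F) (e 3F) refl refl refl))
      pair 4F = sum₂ (label H f₀ ∘ e) 4F 5F
        (cycle+ (e 4F) (e 5F) refl refl refl)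
      -- Edge 0 closes the cycle at vertex 5 and comes first in the order of `edges`.
      pair 5F = sum₂ (label H f₀ ∘ e) 0F 5F
        (cycle+ (e 0F) (e 5F) refl refl refl)

  weightE-cycle : ∀ i t → weightE H f₀ (inj₁ (i , t)) ≡ cycleWeight (edgeColourC t)
  weightE-cycle i = λ where
      0F → label-comm (v 0F) (v 5F) (cycle+ (v 0F) (v 5F) refl refl refl)
      1F → cycle+ (v 0F) (v 1F) refl refl refl
      2F → label-comm (v 2F) (v 1F) (cycle+ (v 2F) (v 1F) refl refl refl)
      3F → cycle+ (v 2F) (v 3F) refl refl refl
      4F → label-comm (v 4F) (v 3F) (cycle+ (v 4F) (v 3F) refl refl refl)
      5F → cycle+ (v 4F) (v 5F) refl refl refl
    where
      v : Fin 6 → V ⊎ E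
      v t = inj₁ (inj₁ (i , t))

  weightV-path : ∀ j t → weightV H f₀ (inj₂ (j , t)) ≡ pathWeight (vertexColour t) (slack j t)
  weightV-path j t = trans (weightV-P₆ m n f₀ j t) (pair t)
    where
      e : Fin 5 → V ⊎ E
      e t = inj₂ (inj₂ (j , t))

      pair : ∀ t → sum (map (label H f₀ ∘ e) (incidentEdges (P 6) t)) ≡
                   pathWeight (vertexColour t) (slack j t)
      pair 0F = trans (+-identityʳ _) (trans (label-value m n (e 0F)) (leaf-label j 1F))
      pair 1F = sum₂ (label H f₀ ∘ e) 0F 1F
        (label-comm (e 1F) (e 0F) (path+ (e 1F) (e 0F) refl refl refl refl))
      pair 2F = sum₂ (label H f₀ ∘ e) 1F 2F
        (path+ (e 1F) (e 2F) refl refl refl refl)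
      pair 3F = sum₂ (label H f₀ ∘ e) 2F 3F
        (label-comm (e 3F) (e 2F) (path+ (e 3F) (e 2F) refl refl refl refl))
      pair 4F = sum₂ (label H f₀ ∘ e) 3F 4F
        (path+ (e 3F) (e 4F) refl refl refl refl)
      pair 5F = trans (+-identityʳ _) (trans (label-value m n (e 4F)) (leaf-label j 0F))

  weightE-path : ∀ j t → weightE H f₀ (inj₂ (j , t)) ≡ pathWeight (edgeColourP t) 0F
  weightE-path j = λ where
      0F → path+ (v 0F) (v 1F) refl refl refl refl
      1F → label-comm (v 2F) (v 1F) (path+ (v 2F) (v 1F) refl refl refl refl)
      2F → path+ (v 2F) (v 3F) refl refl refl refl
      3F → label-comm (v 4F) (v 3F) (path+ (v 4F) (v 3F) refl refl refl refl)
      4F → path+ (v 4F) (v 5F) refl refl refl refl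
    where
      v : Fin 6 → V ⊎ E
      v t = inj₁ (inj₂ (j , t))

  -- Within one component equal weights force equal colours, so the proper colourings carry over.
  -- Cycles and paths may read colours off weights differently, since no incidence joins two
  -- components.
  labeling-isLocalTotalAntimagic : IsLocalTotalAntimagic H f₀
  labeling-isLocalTotalAntimagic = isLocalTotalAntimagic f₀ (IsProper-⊕ {m · C 6} {n · P 6}
    (IsProper-· λ i → IsProper-refine
      (λ u v → cycle-colour (weightV-cycle i u) (weightV-cycle i v))
      (λ e e′ → cycle-colour (weightE-cycle i e) (weightE-cycle i e′))
      (λ v e → cycle-colour (weightV-cycle i v) (weightE-cycle i e)) isProper-C₆)
    (IsProper-· λ j → IsProper-refine
      (λ u v → path-colour (weightV-path j u) (weightV-path j v))
      (λ e e′ → path-colour (weightE-path j e) (weightE-path j e′))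
      (λ v e → path-colour (weightV-path j v) (weightE-path j e)) isProper-P₆))
    where
      cycle-colour : ∀ {w w′ c c′} → w ≡ cycleWeight c → w′ ≡ cycleWeight c′ → w ≡ w′ → c ≡ c′
      cycle-colour refl refl eq = Fin.toℕ-injective (+-cancelˡ-≡ (12 * m + 10 * n) _ _ eq)

      path-colour : ∀ {w w′ c c′ d d′} → w ≡ pathWeight c d → w′ ≡ pathWeight c′ d′ →
                    w ≡ w′ → c ≡ c′
      path-colour {c = c} {c′} {d} {d′} refl refl eq =
        Fin.combine-injectiveˡ c d c′ d′ (Fin.toℕ-injective (+-cancelˡ-≡ b _ _ eq))

  -- Range of the weights and the upper bound.

  InRange : ℕ → Set
  InRange w = ∃[ t ] (t ≤ 2 * n × w ≡ b + t)

  -- The weight is b + (n - 1) + c with c at most 2, and n + 1 is at most 2n because n is positive.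
  cycleWeight-inRange : ∀ c → InRange (cycleWeight c)
  cycleWeight-inRange c = n′ + toℕ c ,
    ≤-trans (+-monoʳ-≤ n′ (s≤s⁻¹ (Fin.toℕ<n c)))
      (≤-trans (m≤m+n _ n′) (≤-reflexive (identity₁ n′))) ,
    identity₀ m n′ (toℕ c)
    where
      identity₀ : ∀ m n′ c → 12 * m + 10 * suc n′ + c ≡ 12 * m + 9 * suc n′ + 1 + (n′ + c)
      identity₀ = solve-∀

      identity₁ : ∀ n′ → n′ + 2 + n′ ≡ 2 * suc n′
      identity₁ = solve-∀

  pathWeight-inRange : ∀ c → InRange (pathWeight c 0F)
  pathWeight-inRange c = toℕ (combine c (zero {n′})) , bound , refl
    where
      open ≤-Reasoning
      bound : toℕ (combine c (zero {n′})) ≤ 2 * n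
      bound = begin
        toℕ (combine c (zero {n′})) ≡⟨ Fin.toℕ-combine c (zero {n′}) ⟩
        n * toℕ c + 0               ≡⟨ +-identityʳ _ ⟩
        n * toℕ c                   ≤⟨ *-monoʳ-≤ n (s≤s⁻¹ (Fin.toℕ<n c)) ⟩
        n * 2                       ≡⟨ *-comm n 2 ⟩
        2 * n                       ∎

  -- Leaves have colour 0 or 1 only, which leaves room for a slack below n. Taking `c` in `Fin 2`
  -- puts `combine c j` in `Fin (2 * n)`, and the bound follows.
  leafWeight-inRange : ∀ (c : Fin 2) j → InRange (pathWeight (inject₁ c) j)
  leafWeight-inRange c j = toℕ (combine (inject₁ c) j) , bound , refl
    where
      open ≤-Reasoning
      bound : toℕ (combine (inject₁ c) j) ≤ 2 * n
      bound = begin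
        toℕ (combine (inject₁ c) j) ≡⟨ Fin.toℕ-combine (inject₁ c) j ⟩
        n * toℕ (inject₁ c) + toℕ j ≡⟨ cong (λ k → n * k + toℕ j) (Fin.toℕ-inject₁ c) ⟩
        n * toℕ c + toℕ j           ≡⟨ Fin.toℕ-combine c j ⟨
        toℕ (combine c j)           ≤⟨ <⇒≤ (Fin.toℕ<n (combine c j)) ⟩
        2 * n                       ∎

  weightV-inRange : ∀ v → InRange (weightV H f₀ v)
  weightV-inRange (inj₁ (i , t)) = subst InRange (sym (weightV-cycle i t))
    (cycleWeight-inRange (vertexColour t))
  weightV-inRange (inj₂ (j , t)) = subst InRange (sym (weightV-path j t)) (inRange t)
    where
      inRange : ∀ t → InRange (pathWeight (vertexColour t) (slack j t))
      inRange 0F = leafWeight-inRange 1F j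
      inRange 1F = pathWeight-inRange 2F
      inRange 2F = pathWeight-inRange 0F
      inRange 3F = pathWeight-inRange 1F
      inRange 4F = pathWeight-inRange 2F
      inRange 5F = leafWeight-inRange 0F j

  weightE-inRange : ∀ e → InRange (weightE H f₀ e)
  weightE-inRange (inj₁ (i , t)) = subst InRange (sym (weightE-cycle i t))
    (cycleWeight-inRange (edgeColourC t))
  weightE-inRange (inj₂ (j , t)) = subst InRange (sym (weightE-path j t))
    (pathWeight-inRange (edgeColourP t))

  numWeights-upper : numWeights H f₀ ≤ 2 * n + 1
  numWeights-upper = ≤-trans (numWeights≤ H f₀ b (2 * n) weightV-inRange weightE-inRange)
    (≤-reflexive (+-comm 1 (2 * n)))

theorem4p3 : (m n : ℕ) → 1 ≤ m → 1 ≤ n →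
    χₗₜ[ m · C 6 ⊕ n · P 6 ]≡ (2 * n + 1)
theorem4p3 m (suc n′) _ _ =
  (labeling m (suc n′) , labeling-isLocalTotalAntimagic m n′ ,
    ≤-antisym (numWeights-upper m n′) (numWeights-lower m n′ (labeling m (suc n′)))) ,
  λ f _ → numWeights-lower m n′ f
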